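{- Let $\mathcal{H}$ be a $3$-regular tripartite $3$-uniform hypergraph. Then $\mathcal{H}$ has a spanning subhypergraph whose degrees are all either $1$ or $2$.
   Context: A hypergraph $\mathcal{H}$ consists of a finite vertex set $V(\mathcal{H})$ and a set $E(\mathcal{H})$ of subsets of $V(\mathcal{H})$, called edges. It is $3$-uniform if every edge has exactly $3$ vertices, and $3$-regular if every vertex lies in exactly $3$ edges. A $3$-uniform hypergraph is tripartite if its vertex set can be partitioned into three sets such that every edge contains exactly one vertex from each of them. A spanning subhypergraph $\mathcal{C}$ of $\mathcal{H}$ is a hypergraph with $V(\mathcal{C})=V(\mathcal{H})$ and $E(\mathcal{C})\subseteq E(\mathcal{H})$; the degree of a vertex in it is the number of edges of $\mathcal{C}$ containing that vertex. -}

module Defs where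

open import Data.Fin using (Fin)
open import Data.Fin.Subset using (Subset; _∈_; _∩_; ∣_∣)
open import Data.Fin.Subset.Properties using (_∈?_)
open import Data.List using (List; length; filter)
open import Data.List.Relation.Binary.Subset.Propositional using (_⊆_)
open import Data.List.Relation.Unary.All using (All)
open import Data.List.Relation.Unary.Unique.Propositional using (Unique)
open import Data.Nat using (ℕ)
open import Data.Product using (∃; ∃!; _×_)
open import Relation.Binary.PropositionalEquality using (_≡_)

-- The vertex set is Fin n.  The edge set is a duplicate-free list; as
-- equality of Subset n is extensional, there are no parallel edges.
record Hypergraph (n : ℕ) : Set where
  field
    edges  : List (Subset n)
    unique : Unique edges

open Hypergraph public

degree : ∀ {n} → Hypergraph n → Fin n → ℕ
degree H v = length (filter (v ∈?_) (edges H))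

Uniform : ∀ {n} → ℕ → Hypergraph n → Set
Uniform k H = All (λ e → ∣ e ∣ ≡ k) (edges H)

Regular : ∀ {n} → ℕ → Hypergraph n → Set
Regular {n} k H = (v : Fin n) → degree H v ≡ k

-- Parts are allowed to be empty.
IsPartition : ∀ {n k} → (Fin k → Subset n) → Set
IsPartition {n} P = (v : Fin n) → ∃! _≡_ (λ i → v ∈ P i)

Tripartite : ∀ {n} → Hypergraph n → Set
Tripartite {n} H =
  ∃ λ (P : Fin 3 → Subset n) →
    IsPartition P × All (λ e → ∀ i → ∣ e ∩ P i ∣ ≡ 1) (edges H)

-- Both hypergraphs have vertex set Fin n, so C is automatically spanning.
SpanningSubhypergraph : ∀ {n} → Hypergraph n → Hypergraph n → Set
SpanningSubhypergraph C H = edges C ⊆ edges H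

{-# OPTIONS --safe #-}

-- It suffices to colour the edges with two colours so that no vertex sees only
-- one of them (Seymour's linear algebra argument for hypergraph 2-colouring).
-- Give each edge an unknown and each vertex the equation that the unknowns of
-- its three edges sum to zero.  There are as many equations as unknowns, but
-- the equations of each part add up to the sum of all unknowns, so there is a
-- nonzero solution; colour the edges by its sign.  A vertex with a nonzero
-- edge sees both signs.  The remaining vertices have all their edges among
-- those of value zero, and one recurses on these.  By double counting there are
-- still at most as many equations as unknowns, and in the case of equality the
-- vertices of each part again cover every edge exactly once.
module Submission where

open import Defs
open import Data.Bool using (Bool; true; false; if_then_else_)
open import Data.Bool.Properties using () renaming (_≟_ to _≟ᵇ_)
open import Data.Fin using (Fin; zero; suc)
open import Data.Fin.Patterns using (0F; 1F; 2F)
open import Data.Fin.Subset using (Subset; _∈_; _∩_; ∣_∣)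
open import Data.Fin.Subset.Properties using (_∈?_; x∈p∩q⁺; x∈p∩q⁻)
open import Data.Integer using (ℤ; +_; -[1+_]; 0ℤ; 1ℤ; _≤_; _<_; +≤+)
import Data.Integer as ℤ
import Data.Integer.Properties as ℤ
open import Data.Integer.Tactic.RingSolver using (solve-∀)
open import Data.List using (List; []; _∷_; _++_; length; map; filter; tabulate; allFin)
open import Data.List.Membership.Propositional using (find; lose) renaming (_∈_ to _∈ₗ_)
open import Data.List.Membership.Propositional.Properties
  using (∈-∃++; ∈-++⁻; ∈-++⁺ˡ; ∈-++⁺ʳ; ∈-filter⁺; ∈-filter⁻; ∈-map⁺; ∈-map⁻; ∈-allFin)
open import Data.List.Properties using (length-map; length-++; filter-notAll; filter-some; map-tabulate)
open import Data.List.Relation.Binary.Subset.Propositional.Properties using (filter-⊆)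
open import Data.List.Relation.Unary.All as All using (All; all?)
import Data.List.Relation.Unary.All.Properties as All
open import Data.List.Relation.Unary.Any as Any using (Any; here; there; any?)
open import Data.List.Relation.Unary.AllPairs using (_∷_)
open import Data.List.Relation.Unary.Unique.Propositional using (Unique)
import Data.List.Relation.Unary.Unique.Propositional.Properties as Unique
open import Data.Nat using (ℕ; zero; suc; z≤n; s≤s)
import Data.Nat as ℕ
import Data.Nat.Properties as ℕ
import Data.Nat.Tactic.RingSolver as ℕ-Solver
open import Data.Product using (∃; _×_; _,_; proj₁; proj₂)
open import Data.Sum using (_⊎_; inj₁; inj₂)
open import Data.Vec using ([]; _∷_)
import Data.Vec.Properties as Vec
open import Function using (_∘_)
open import Relation.Binary.Definitions using (DecidableEquality)
open import Relation.Binary.PropositionalEquality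
open import Relation.Nullary using (does; yes; no; ¬?; contradiction)
open import Relation.Nullary.Decidable using (dec-true; dec-false)
open import Relation.Unary using (Decidable)

private variable
  A B : Set

-- Integer sums over lists.

∑ : List A → (A → ℤ) → ℤ
∑ []       f = 0ℤ
∑ (x ∷ xs) f = f x ℤ.+ ∑ xs f

∑-cong : (xs : List A) {f g : A → ℤ} → (∀ {x} → x ∈ₗ xs → f x ≡ g x) → ∑ xs f ≡ ∑ xs g
∑-cong []       f≡g = refl
∑-cong (x ∷ xs) f≡g = cong₂ ℤ._+_ (f≡g (here refl)) (∑-cong xs (f≡g ∘ there))

∑-zero : (xs : List A) → ∑ xs (λ _ → 0ℤ) ≡ 0ℤ
∑-zero []       = refl
∑-zero (x ∷ xs) = trans (ℤ.+-identityˡ _) (∑-zero xs)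

∑-const : (c : ℕ) (xs : List A) → ∑ xs (λ _ → + c) ≡ + (length xs ℕ.* c)
∑-const c []       = refl
∑-const c (x ∷ xs) = trans (cong (λ s → + c ℤ.+ s) (∑-const c xs)) (sym (ℤ.pos-+ c _))

∑-distrib-+ : (xs : List A) (f g : A → ℤ) → ∑ xs (λ x → f x ℤ.+ g x) ≡ ∑ xs f ℤ.+ ∑ xs g
∑-distrib-+ []       f g = refl
∑-distrib-+ (x ∷ xs) f g =
  trans (cong (λ s → f x ℤ.+ g x ℤ.+ s) (∑-distrib-+ xs f g)) (rearrange (f x) (g x) (∑ xs f) (∑ xs g))
  where
  rearrange : ∀ a b c d → a ℤ.+ b ℤ.+ (c ℤ.+ d) ≡ a ℤ.+ c ℤ.+ (b ℤ.+ d)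
  rearrange = solve-∀

*-distribˡ-∑ : (a : ℤ) (xs : List A) (f : A → ℤ) → a ℤ.* ∑ xs f ≡ ∑ xs (λ x → a ℤ.* f x)
*-distribˡ-∑ a []       f = ℤ.*-zeroʳ a
*-distribˡ-∑ a (x ∷ xs) f =
  trans (ℤ.*-distribˡ-+ a (f x) (∑ xs f)) (cong (λ s → a ℤ.* f x ℤ.+ s) (*-distribˡ-∑ a xs f))

*-distribʳ-∑ : (a : ℤ) (xs : List A) (f : A → ℤ) → ∑ xs f ℤ.* a ≡ ∑ xs (λ x → f x ℤ.* a)
*-distribʳ-∑ a []       f = ℤ.*-zeroˡ a
*-distribʳ-∑ a (x ∷ xs) f =
  trans (ℤ.*-distribʳ-+ a (f x) (∑ xs f)) (cong (λ s → f x ℤ.* a ℤ.+ s) (*-distribʳ-∑ a xs f))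

∑-comm : (xs : List A) (ys : List B) (f : A → B → ℤ) →
         ∑ xs (λ x → ∑ ys (f x)) ≡ ∑ ys (λ y → ∑ xs (λ x → f x y))
∑-comm []       ys f = sym (∑-zero ys)
∑-comm (x ∷ xs) ys f =
  trans (cong (λ s → ∑ ys (f x) ℤ.+ s) (∑-comm xs ys f)) (sym (∑-distrib-+ ys _ _))

∑-map : (g : A → B) (xs : List A) (f : B → ℤ) → ∑ (map g xs) f ≡ ∑ xs (f ∘ g)
∑-map g []       f = refl
∑-map g (x ∷ xs) f = cong (λ s → f (g x) ℤ.+ s) (∑-map g xs f)

∑-mono-≤ : (xs : List A) {f g : A → ℤ} → (∀ {x} → x ∈ₗ xs → f x ≤ g x) → ∑ xs f ≤ ∑ xs g
∑-mono-≤ []       f≤g = ℤ.≤-refl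
∑-mono-≤ (x ∷ xs) f≤g = ℤ.+-mono-≤ (f≤g (here refl)) (∑-mono-≤ xs (f≤g ∘ there))

-- A single strict term would make the whole sum strictly smaller, so the reverse inequality between
-- the sums leaves no slack anywhere. This is how equality in a double count is exploited.
∑-≤-rigid : (xs : List A) {f g : A → ℤ} → (∀ {x} → x ∈ₗ xs → f x ≤ g x) →
            ∑ xs g ≤ ∑ xs f → ∀ {x} → x ∈ₗ xs → f x ≡ g x
∑-≤-rigid (x ∷ xs) {f} {g} f≤g ∑g≤∑f x∈ with f x ℤ.≟ g x
... | no fx≢gx = contradiction ∑g≤∑f
  (ℤ.<⇒≱ (ℤ.+-mono-<-≤ (ℤ.≤∧≢⇒< (f≤g (here refl)) fx≢gx) (∑-mono-≤ xs (f≤g ∘ there))))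
∑-≤-rigid (x ∷ xs) f≤g ∑g≤∑f (here refl) | yes fx≡gx = fx≡gx
∑-≤-rigid (x ∷ xs) {f} {g} f≤g ∑g≤∑f (there x∈) | yes fx≡gx =
  ∑-≤-rigid xs (f≤g ∘ there) ∑g≤∑f′ x∈
  where
  ∑g≤∑f′ : ∑ xs g ≤ ∑ xs f
  ∑g≤∑f′ = ℤ.≮⇒≥ λ ∑f<∑g →
    ℤ.<⇒≱ (ℤ.+-mono-≤-< (ℤ.≤-reflexive fx≡gx) ∑f<∑g) ∑g≤∑f

∑-filter : {P : A → Set} (P? : Decidable P) (xs : List A) {f : A → ℤ} →
           ∑ (filter P? xs) f ≡ ∑ xs (λ x → if does (P? x) then f x else 0ℤ)
∑-filter P? []       = refl
∑-filter P? (x ∷ xs) {f} with does (P? x)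
... | true  = cong (λ s → f x ℤ.+ s) (∑-filter P? xs)
... | false = trans (∑-filter P? xs) (sym (ℤ.+-identityˡ _))

∑-filter-≤ : {P : A → Set} (P? : Decidable P) (xs : List A) {f : A → ℤ} →
             (∀ {x} → x ∈ₗ xs → 0ℤ ≤ f x) → ∑ (filter P? xs) f ≤ ∑ xs f
∑-filter-≤ P? xs {f} 0≤f = subst (_≤ ∑ xs f) (sym (∑-filter P? xs)) (∑-mono-≤ xs bound)
  where
  bound : ∀ {x} → x ∈ₗ xs → (if does (P? x) then f x else 0ℤ) ≤ f x
  bound {x} x∈ with does (P? x)
  ... | true  = ℤ.≤-refl
  ... | false = 0≤f x∈

-- Were no term positive, all would be at most zero with the same sum as the zero function, and
-- rigidity would force every term to vanish.
∑≡0⇒∃>0 : (xs : List A) (f : A → ℤ) → ∑ xs f ≡ 0ℤ → Any (λ x → f x ≢ 0ℤ) xs →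
          Any (λ x → 0ℤ < f x) xs
∑≡0⇒∃>0 xs f ∑f≡0 f≢0 with any? (λ x → 0ℤ ℤ.<? f x) xs
... | yes 0<f = 0<f
... | no  0≮f with find f≢0
...   | x , x∈ , fx≢0 = contradiction
  (∑-≤-rigid xs (λ y∈ → ℤ.≮⇒≥ (0≮f ∘ lose y∈)) (ℤ.≤-reflexive (trans (∑-zero xs) (sym ∑f≡0))) x∈) fx≢0

-- Nonzero integer solutions of homogeneous linear systems.

module Kernel {A : Set} (_≟_ : DecidableEquality A) where

  infixl 6 _[_↦_]
  _[_↦_] : (A → ℤ) → A → ℤ → A → ℤ
  (y [ x ↦ c ]) z = if does (z ≟ x) then c else y z

  lookup-↦ : ∀ y x c → (y [ x ↦ c ]) x ≡ c
  lookup-↦ y x c rewrite dec-true (x ≟ x) refl = refl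

  lookup-↦-∉ : ∀ y {x z} c {xs} → All (x ≢_) xs → z ∈ₗ xs → (y [ x ↦ c ]) z ≡ y z
  lookup-↦-∉ y {x} {z} c x∉ z∈ rewrite dec-false (z ≟ x) (All.lookup x∉ z∈ ∘ sym) = refl

  ∑-↦ : ∀ (f : A → ℤ) y {x} c {xs} → All (x ≢_) xs →
        ∑ (x ∷ xs) (λ z → f z ℤ.* (y [ x ↦ c ]) z) ≡ f x ℤ.* c ℤ.+ ∑ xs (λ z → f z ℤ.* y z)
  ∑-↦ f y {x} c {xs} x∉ = cong₂ (λ a s → f x ℤ.* a ℤ.+ s) (lookup-↦ y x c)
    (∑-cong xs λ {z} z∈ → cong (λ s → f z ℤ.* s) (lookup-↦-∉ y c x∉ z∈))

  -- Fraction-free Gaussian elimination, with pivot f x.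
  kernel : (fs : List (A → ℤ)) (xs : List A) → Unique xs → length fs ℕ.< length xs →
           ∃ λ (y : A → ℤ) → Any (λ x → y x ≢ 0ℤ) xs ×
                   (∀ {f} → f ∈ₗ fs → ∑ xs (λ x → f x ℤ.* y x) ≡ 0ℤ)
  kernel fs (x ∷ xs) (x∉ ∷ uniq) (s≤s ∣fs∣≤) with any? (λ f → ¬? (f x ℤ.≟ 0ℤ)) fs
  -- No form involves the unknown `x`, so the indicator function of `x` solves every equation.
  ... | no fx≡0 = y , here (λ yx≡0 → contradiction (trans (sym (lookup-↦ (λ _ → 0ℤ) x 1ℤ)) yx≡0) λ ()) , solves
    where
    y = (λ _ → 0ℤ) [ x ↦ 1ℤ ]
    solves : ∀ {f} → f ∈ₗ fs → ∑ (x ∷ xs) (λ z → f z ℤ.* y z) ≡ 0ℤ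
    solves {f} f∈ with f x ℤ.≟ 0ℤ
    ... | no ≢0 = contradiction (lose f∈ ≢0) fx≡0
    ... | yes ≡0 = begin
      ∑ (x ∷ xs) (λ z → f z ℤ.* y z)               ≡⟨ ∑-↦ f (λ _ → 0ℤ) 1ℤ x∉ ⟩
      f x ℤ.* 1ℤ ℤ.+ ∑ xs (λ z → f z ℤ.* 0ℤ)      ≡⟨ cong₂ ℤ._+_ (cong (ℤ._* 1ℤ) ≡0) (trans (∑-cong xs λ {z} _ → ℤ.*-zeroʳ (f z)) (∑-zero xs)) ⟩
      0ℤ                                           ∎
      where open ≡-Reasoning
  ... | yes fx≢0 with find fx≢0
  ...   | f , f∈ , a≢0 with ∈-∃++ f∈
  ...     | gs , hs , refl with kernel (map eliminate (gs ++ hs)) xs uniq fewer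
    where
    -- Cross-multiplying with the pivot `f` makes the coefficient at `x` vanish without division.
    -- Both the pivot equation and the unknown `x` disappear, which preserves the strict inequality.
    eliminate : (A → ℤ) → A → ℤ
    eliminate g z = f x ℤ.* g z ℤ.- g x ℤ.* f z
    fewer : length (map eliminate (gs ++ hs)) ℕ.< length xs
    fewer = ℕ.≤-trans (ℕ.≤-reflexive (begin
      suc (length (map eliminate (gs ++ hs))) ≡⟨ cong suc (length-map eliminate (gs ++ hs)) ⟩
      suc (length (gs ++ hs))                 ≡⟨ cong suc (length-++ gs) ⟩
      suc (length gs ℕ.+ length hs)           ≡⟨ ℕ.+-suc (length gs) (length hs) ⟨
      length gs ℕ.+ length (f ∷ hs)           ≡⟨ length-++ gs ⟨
      length (gs ++ f ∷ hs)                   ∎)) ∣fs∣≤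
      where open ≡-Reasoning
  ...       | y , y≢0 , y-solves = y⁺ , there y⁺≢0 , solves
    where
    a = f x
    s = ∑ xs (λ z → f z ℤ.* y z)
    -- Over the rationals one would keep `y` and give `x` the value -s/a, as the pivot equation
    -- demands. Scaling everything by `a` clears the denominator.
    y⁺ = (λ z → a ℤ.* y z) [ x ↦ ℤ.- s ]

    y⁺≢0 : Any (λ z → y⁺ z ≢ 0ℤ) xs
    y⁺≢0 with find y≢0
    -- Scaling by the nonzero pivot `a` preserves nonzero entries, as the integers have no zero
    -- divisors.
    ... | z , z∈ , yz≢0 = lose z∈ λ y⁺z≡0 →
      case (ℤ.i*j≡0⇒i≡0∨j≡0 a (trans (sym (lookup-↦-∉ (λ z → a ℤ.* y z) (ℤ.- s) x∉ z∈)) y⁺z≡0))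
      where
      case : a ≡ 0ℤ ⊎ y z ≡ 0ℤ → _
      case (inj₁ a≡0)  = a≢0 a≡0
      case (inj₂ yz≡0) = yz≢0 yz≡0

    scale : ∀ g → ∑ xs (λ z → g z ℤ.* (a ℤ.* y z)) ≡ a ℤ.* ∑ xs (λ z → g z ℤ.* y z)
    scale g = trans (∑-cong xs λ {z} _ → swap (g z) a (y z)) (sym (*-distribˡ-∑ a xs (λ z → g z ℤ.* y z)))
      where
      swap : ∀ p q r → p ℤ.* (q ℤ.* r) ≡ q ℤ.* (p ℤ.* r)
      swap = solve-∀

    solves-pivot : ∑ (x ∷ xs) (λ z → f z ℤ.* y⁺ z) ≡ 0ℤ
    solves-pivot = trans (∑-↦ f (λ z → a ℤ.* y z) (ℤ.- s) x∉) (trans (cong (λ t → a ℤ.* ℤ.- s ℤ.+ t) (scale f)) (cancel a s))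
      where
      cancel : ∀ a s → a ℤ.* ℤ.- s ℤ.+ a ℤ.* s ≡ 0ℤ
      cancel = solve-∀

    solves-other : ∀ {g} → g ∈ₗ gs ++ hs → ∑ (x ∷ xs) (λ z → g z ℤ.* y⁺ z) ≡ 0ℤ
    solves-other {g} g∈ = begin
      ∑ (x ∷ xs) (λ z → g z ℤ.* y⁺ z)                                      ≡⟨ ∑-↦ g (λ z → a ℤ.* y z) (ℤ.- s) x∉ ⟩
      b ℤ.* ℤ.- s ℤ.+ ∑ xs (λ z → g z ℤ.* (a ℤ.* y z))                     ≡⟨ ℤ.+-comm (b ℤ.* ℤ.- s) _ ⟩
      ∑ xs (λ z → g z ℤ.* (a ℤ.* y z)) ℤ.+ b ℤ.* ℤ.- s                     ≡⟨ cong₂ ℤ._+_ (∑-cong xs λ {z} _ → regroup₁ (g z) a (y z)) (sym (ℤ.neg-distribʳ-* b s)) ⟩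
      ∑ xs (λ z → a ℤ.* g z ℤ.* y z) ℤ.- b ℤ.* s                           ≡⟨ cong (λ t → ∑ xs (λ z → a ℤ.* g z ℤ.* y z) ℤ.+ t) (trans (ℤ.neg-distribˡ-* b s) (*-distribˡ-∑ (ℤ.- b) xs (λ z → f z ℤ.* y z))) ⟩
      ∑ xs (λ z → a ℤ.* g z ℤ.* y z) ℤ.+ ∑ xs (λ z → ℤ.- b ℤ.* (f z ℤ.* y z)) ≡⟨ ∑-distrib-+ xs (λ z → a ℤ.* g z ℤ.* y z) _ ⟨
      ∑ xs (λ z → a ℤ.* g z ℤ.* y z ℤ.+ ℤ.- b ℤ.* (f z ℤ.* y z))           ≡⟨ ∑-cong xs (λ {z} _ → regroup₂ a (g z) (y z) b (f z)) ⟩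
      ∑ xs (λ z → (a ℤ.* g z ℤ.- b ℤ.* f z) ℤ.* y z)                       ≡⟨ y-solves (∈-map⁺ _ g∈) ⟩
      0ℤ                                                                   ∎
      where
      open ≡-Reasoning
      b = g x
      regroup₁ : ∀ p a q → p ℤ.* (a ℤ.* q) ≡ a ℤ.* p ℤ.* q
      regroup₁ = solve-∀
      regroup₂ : ∀ a p q b r → a ℤ.* p ℤ.* q ℤ.+ ℤ.- b ℤ.* (r ℤ.* q) ≡ (a ℤ.* p ℤ.- b ℤ.* r) ℤ.* q
      regroup₂ = solve-∀

    solves : ∀ {g} → g ∈ₗ gs ++ f ∷ hs → ∑ (x ∷ xs) (λ z → g z ℤ.* y⁺ z) ≡ 0ℤ
    solves g∈ with ∈-++⁻ gs g∈
    ... | inj₁ g∈gs         = solves-other (∈-++⁺ˡ g∈gs)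
    ... | inj₂ (here refl)  = solves-pivot
    ... | inj₂ (there g∈hs) = solves-other (∈-++⁺ʳ gs g∈hs)

  -- Insert the factor 1 given by the cover and exchange the two sums. The total of `y` is thus
  -- determined by the values of the forms in any one cover, so two covers yield a linear dependence
  -- among the equations.
  ∑-via-cover : (V : List (A → ℤ)) (xs : List A) → (∀ {x} → x ∈ₗ xs → ∑ V (λ f → f x) ≡ 1ℤ) →
                (y : A → ℤ) → ∑ xs y ≡ ∑ V (λ f → ∑ xs (λ x → f x ℤ.* y x))
  ∑-via-cover V xs cover y = begin
    ∑ xs y                                   ≡⟨ ∑-cong xs (λ {x} x∈ → trans (sym (ℤ.*-identityˡ (y x))) (cong (ℤ._* y x) (sym (cover x∈)))) ⟩
    ∑ xs (λ x → ∑ V (λ f → f x) ℤ.* y x)     ≡⟨ ∑-cong xs (λ {x} _ → *-distribʳ-∑ (y x) V (λ f → f x)) ⟩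
    ∑ xs (λ x → ∑ V (λ f → f x ℤ.* y x))     ≡⟨ ∑-comm xs V (λ x f → f x ℤ.* y x) ⟩
    ∑ V (λ f → ∑ xs (λ x → f x ℤ.* y x))     ∎
    where open ≡-Reasoning

  -- The forms in U and those in V have the same sum, so one equation is redundant.
  kernel-double-cover :
    (U V W : List (A → ℤ)) (xs : List A) → Unique xs → 0 ℕ.< length xs →
    (∀ {x} → x ∈ₗ xs → ∑ U (λ f → f x) ≡ 1ℤ) → (∀ {x} → x ∈ₗ xs → ∑ V (λ f → f x) ≡ 1ℤ) →
    length (U ++ V ++ W) ℕ.≤ length xs →
    ∃ λ (y : A → ℤ) → Any (λ x → y x ≢ 0ℤ) xs ×
      (∀ {f} → f ∈ₗ U ++ V ++ W → ∑ xs (λ x → f x ℤ.* y x) ≡ 0ℤ)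
  kernel-double-cover []      V W (x ∷ xs) uniq _ coverU coverV ∣fs∣≤ = contradiction (coverU (here refl)) λ ()
  kernel-double-cover (g ∷ U) V W xs       uniq _ coverU coverV ∣fs∣≤
    -- Dropping `g` turns the weak bound on the number of equations into the strict one needed for
    -- elimination.
    with kernel (U ++ V ++ W) xs uniq ∣fs∣≤
  ... | y , y≢0 , solves = y , y≢0 , solves⁺
    where
    open ≡-Reasoning
    value : (A → ℤ) → ℤ
    value f = ∑ xs (λ x → f x ℤ.* y x)

    solves⁺ : ∀ {f} → f ∈ₗ g ∷ U ++ V ++ W → value f ≡ 0ℤ
    solves⁺ (there f∈)  = solves f∈
    -- The equation of `g` is recovered: all other forms in its cover have value zero, so its value
    -- is the total of `y`, and this is zero when computed through `V`.
    solves⁺ (here refl) = begin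
      value g                   ≡⟨ ℤ.+-identityʳ (value g) ⟨
      value g ℤ.+ 0ℤ            ≡⟨ cong (λ s → value g ℤ.+ s) (trans (∑-cong U (solves ∘ ∈-++⁺ˡ)) (∑-zero U)) ⟨
      ∑ (g ∷ U) value           ≡⟨ ∑-via-cover (g ∷ U) xs coverU y ⟨
      ∑ xs y                    ≡⟨ ∑-via-cover V xs coverV y ⟩
      ∑ V value                 ≡⟨ ∑-cong V (solves ∘ ∈-++⁺ʳ U ∘ ∈-++⁺ˡ) ⟩
      ∑ V (λ _ → 0ℤ)            ≡⟨ ∑-zero V ⟩
      0ℤ                        ∎

-- Double counting vertices against edges.

module _ (a b c : ℕ) {z : ℕ} (3a≤z : a ℕ.* 3 ℕ.≤ z) (3b≤z : b ℕ.* 3 ℕ.≤ z) (3c≤z : c ℕ.* 3 ℕ.≤ z) where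

  private
    distrib : ∀ a b c → (a ℕ.+ (b ℕ.+ c)) ℕ.* 3 ≡ a ℕ.* 3 ℕ.+ (b ℕ.* 3 ℕ.+ c ℕ.* 3)
    distrib = ℕ-Solver.solve-∀

    triple : ∀ z → z ℕ.+ (z ℕ.+ z) ≡ z ℕ.* 3
    triple = ℕ-Solver.solve-∀

  thirds-sum-≤ : a ℕ.+ (b ℕ.+ c) ℕ.≤ z
  thirds-sum-≤ = ℕ.*-cancelʳ-≤ _ _ 3 (begin
    (a ℕ.+ (b ℕ.+ c)) ℕ.* 3               ≡⟨ distrib a b c ⟩
    a ℕ.* 3 ℕ.+ (b ℕ.* 3 ℕ.+ c ℕ.* 3)     ≤⟨ ℕ.+-mono-≤ 3a≤z (ℕ.+-mono-≤ 3b≤z 3c≤z) ⟩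
    z ℕ.+ (z ℕ.+ z)                       ≡⟨ triple z ⟩
    z ℕ.* 3                               ∎)
    where open ℕ.≤-Reasoning

  -- Of the total 3z the second and third parts account for at most z each, so the first must
  -- account for the remaining z. With `thirds-sum-≤` this says that equality overall forces
  -- equality in each part.
  third-≥ : z ℕ.≤ a ℕ.+ (b ℕ.+ c) → z ℕ.≤ a ℕ.* 3
  third-≥ z≤ = ℕ.+-cancelʳ-≤ (z ℕ.+ z) z (a ℕ.* 3) (begin
    z ℕ.+ (z ℕ.+ z)                       ≡⟨ triple z ⟩
    z ℕ.* 3                               ≤⟨ ℕ.*-monoˡ-≤ 3 z≤ ⟩
    (a ℕ.+ (b ℕ.+ c)) ℕ.* 3               ≡⟨ distrib a b c ⟩
    a ℕ.* 3 ℕ.+ (b ℕ.* 3 ℕ.+ c ℕ.* 3)     ≤⟨ ℕ.+-monoʳ-≤ (a ℕ.* 3) (ℕ.+-mono-≤ 3b≤z 3c≤z) ⟩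
    a ℕ.* 3 ℕ.+ (z ℕ.+ z)                 ∎)
    where open ℕ.≤-Reasoning

-- Each form is the incidence function, on the edges Z, of a vertex; the
-- vertices of one part meet every edge at most once.
record Cubic {A : Set} (U : Fin 3 → List (A → ℤ)) (Z : List A) : Set where
  field
    nonneg : ∀ i {f} → f ∈ₗ U i → ∀ x → 0ℤ ≤ f x
    total  : ∀ i {f} → f ∈ₗ U i → ∑ Z f ≡ + 3
    packed : ∀ i {x} → x ∈ₗ Z → ∑ (U i) (λ f → f x) ≤ 1ℤ

  private
    ∑-cover : ∀ i → ∑ Z (λ x → ∑ (U i) (λ f → f x)) ≡ + (length (U i) ℕ.* 3)
    ∑-cover i = trans (∑-comm Z (U i) (λ x f → f x)) (trans (∑-cong (U i) (total i)) (∑-const 3 (U i)))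

    ∑-one : ∑ Z (λ _ → 1ℤ) ≡ + length Z
    ∑-one = trans (∑-const 1 Z) (cong +_ (ℕ.*-identityʳ (length Z)))

  -- Count incidences twice: every form contributes three, every edge at most one.
  3∣U∣≤∣Z∣ : ∀ i → length (U i) ℕ.* 3 ℕ.≤ length Z
  3∣U∣≤∣Z∣ i = ℤ.drop‿+≤+ (subst₂ _≤_ (∑-cover i) ∑-one (∑-mono-≤ Z (packed i)))

  -- Equality in the double count makes the packing bound tight at every edge.
  cover : ∀ i → length Z ℕ.≤ length (U i) ℕ.* 3 → ∀ {x} → x ∈ₗ Z → ∑ (U i) (λ f → f x) ≡ 1ℤ
  cover i ∣Z∣≤ = ∑-≤-rigid Z (packed i) (subst₂ _≤_ (sym ∑-one) (sym (∑-cover i)) (+≤+ ∣Z∣≤))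

-- Colouring by sign.

Bichromatic : {A : Set} → (A → Bool) → (A → ℤ) → List A → Set
Bichromatic c f xs = ∀ b → Any (λ x → f x ≢ 0ℤ × c x ≡ b) xs

-- The second argument is a fallback colour for edges on which the solution vanishes; the recursion
-- supplies it.
bySign : ℤ → Bool → Bool
bySign ℤ.+[1+ _ ] _ = true
bySign (+ 0)      b = b
bySign -[1+ _ ]   _ = false

bySign-pos : ∀ {a} b → 0ℤ < a → bySign a b ≡ true
bySign-pos {ℤ.+[1+ _ ]} b _ = refl
bySign-pos {+ 0}        b (ℤ.+<+ ())

bySign-neg : ∀ {a} b → 0ℤ < ℤ.- a → bySign a b ≡ false
bySign-neg { -[1+ _ ]} b _ = refl
bySign-neg {+ 0}       b (ℤ.+<+ ())

pos-factors : ∀ {a b} → 0ℤ ≤ a → 0ℤ < a ℤ.* b → a ≢ 0ℤ × 0ℤ < b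
pos-factors {+ 0}        {b}          _ (ℤ.+<+ ())
pos-factors {ℤ.+[1+ m ]} {ℤ.+[1+ n ]} _ _    = (λ ()) , ℤ.+<+ (s≤s z≤n)
pos-factors {ℤ.+[1+ m ]} {+ 0}        _ 0<ab =
  contradiction (subst (0ℤ <_) (ℤ.*-zeroʳ ℤ.+[1+ m ]) 0<ab) (ℤ.<-irrefl refl)

-- A zero sum with a nonzero term has a positive term, and since the coefficient there is
-- nonnegative, the sign is that of `y`.
pos-in-support : (xs : List A) {f y : A → ℤ} → (∀ x → 0ℤ ≤ f x) →
                 ∑ xs (λ x → f x ℤ.* y x) ≡ 0ℤ → Any (λ x → f x ℤ.* y x ≢ 0ℤ) xs →
                 Any (λ x → f x ≢ 0ℤ × 0ℤ < y x) xs
pos-in-support xs {f} {y} 0≤f ∑≡0 ≢0 =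
  Any.map (λ {x} → pos-factors {f x} {y x} (0≤f x)) (∑≡0⇒∃>0 xs (λ x → f x ℤ.* y x) ∑≡0 ≢0)

neg-in-support : (xs : List A) {f y : A → ℤ} → (∀ x → 0ℤ ≤ f x) →
                 ∑ xs (λ x → f x ℤ.* y x) ≡ 0ℤ → Any (λ x → f x ℤ.* y x ≢ 0ℤ) xs →
                 Any (λ x → f x ≢ 0ℤ × 0ℤ < ℤ.- y x) xs
neg-in-support xs {f} {y} 0≤f ∑≡0 ≢0 = pos-in-support xs {f} {λ x → ℤ.- y x} 0≤f
  (begin
    ∑ xs (λ x → f x ℤ.* ℤ.- y x)              ≡⟨ ∑-cong xs (λ {x} _ → flip (f x) (y x)) ⟩
    ∑ xs (λ x → ℤ.-1ℤ ℤ.* (f x ℤ.* y x))      ≡⟨ *-distribˡ-∑ ℤ.-1ℤ xs (λ x → f x ℤ.* y x) ⟨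
    ℤ.-1ℤ ℤ.* ∑ xs (λ x → f x ℤ.* y x)        ≡⟨ cong (ℤ.-1ℤ ℤ.*_) ∑≡0 ⟩
    0ℤ                                        ∎)
  (Any.map (λ {x} fy≢0 f[-y]≡0 → fy≢0 (ℤ.neg-injective (trans (ℤ.neg-distribʳ-* (f x) (y x)) f[-y]≡0))) ≢0)
  where
  open ≡-Reasoning
  flip : ∀ a b → a ℤ.* ℤ.- b ≡ ℤ.-1ℤ ℤ.* (a ℤ.* b)
  flip = solve-∀

-- The recursive two-colouring.

module Colouring {A : Set} (_≟_ : DecidableEquality A) where
  open Kernel _≟_

  cubic-kernel : (U : Fin 3 → List (A → ℤ)) (Z : List A) → Unique Z → 0 ℕ.< length Z → Cubic U Z →
                 ∃ λ (y : A → ℤ) → Any (λ x → y x ≢ 0ℤ) Z ×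
                   (∀ i {f} → f ∈ₗ U i → ∑ Z (λ x → f x ℤ.* y x) ≡ 0ℤ)
  cubic-kernel U Z uniq Z≢[] cubic =
    let y , y≢0 , solves = solution in y , y≢0 , λ i f∈ → solves (part⊆forms i f∈)
    where
    open Cubic cubic
    forms = U 0F ++ U 1F ++ U 2F
    a = length (U 0F)
    b = length (U 1F)
    c = length (U 2F)

    ∣forms∣ : length forms ≡ a ℕ.+ (b ℕ.+ c)
    ∣forms∣ = trans (length-++ (U 0F)) (cong (a ℕ.+_) (length-++ (U 1F)))

    Solution = λ (y : A → ℤ) → Any (λ x → y x ≢ 0ℤ) Z ×
                 (∀ {f} → f ∈ₗ forms → ∑ Z (λ x → f x ℤ.* y x) ≡ 0ℤ)

    solution : ∃ Solution
    solution with length forms ℕ.<? length Z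
    ... | yes fewer = kernel forms Z uniq fewer
    -- The counts now agree, so all parts are tight; the first two of them serve as the two covers.
    ... | no ¬fewer = kernel-double-cover (U 0F) (U 1F) (U 2F) Z uniq Z≢[]
      (cover 0F (third-≥ a b c (3∣U∣≤∣Z∣ 0F) (3∣U∣≤∣Z∣ 1F) (3∣U∣≤∣Z∣ 2F) ∣Z∣≤))
      (cover 1F (third-≥ b a c (3∣U∣≤∣Z∣ 1F) (3∣U∣≤∣Z∣ 0F) (3∣U∣≤∣Z∣ 2F) (subst (length Z ℕ.≤_) (exchange a b c) ∣Z∣≤)))
      (subst (ℕ._≤ length Z) (sym ∣forms∣) (thirds-sum-≤ a b c (3∣U∣≤∣Z∣ 0F) (3∣U∣≤∣Z∣ 1F) (3∣U∣≤∣Z∣ 2F)))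
      where
      ∣Z∣≤ : length Z ℕ.≤ a ℕ.+ (b ℕ.+ c)
      ∣Z∣≤ = subst (length Z ℕ.≤_) ∣forms∣ (ℕ.≮⇒≥ ¬fewer)
      exchange : ∀ a b c → a ℕ.+ (b ℕ.+ c) ≡ b ℕ.+ (a ℕ.+ c)
      exchange = ℕ-Solver.solve-∀

    part⊆forms : ∀ i {f} → f ∈ₗ U i → f ∈ₗ forms
    part⊆forms 0F = ∈-++⁺ˡ
    part⊆forms 1F = ∈-++⁺ʳ (U 0F) ∘ ∈-++⁺ˡ
    part⊆forms 2F = ∈-++⁺ʳ (U 0F) ∘ ∈-++⁺ʳ (U 1F)

  -- The bound `k` on the length is the termination measure, since a filtered list is not
  -- structurally smaller.
  two-colouring : ∀ k (Z : List A) → length Z ℕ.≤ k → Unique Z →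
                  (U : Fin 3 → List (A → ℤ)) → Cubic U Z →
                  ∃ λ (c : A → Bool) → ∀ i {f} → f ∈ₗ U i → Bichromatic c f Z
  -- Without edges there can be no form either, as its total would be 0 instead of 3.
  two-colouring k [] _ _ U cubic = (λ _ → true) , λ i f∈ → contradiction (total i f∈) λ ()
    where open Cubic cubic
  two-colouring (suc k) Z@(_ ∷ _) ∣Z∣≤ uniq U cubic
    with cubic-kernel U Z uniq (s≤s z≤n) cubic
  ... | y , y≢0 , solves = colour , bichromatic
    where
    open Cubic cubic

    zero? : Decidable (λ x → y x ≡ 0ℤ)
    zero? x = y x ℤ.≟ 0ℤ

    Untouched : (A → ℤ) → Set
    Untouched f = All (λ x → f x ℤ.* y x ≡ 0ℤ) Z

    untouched? : Decidable Untouched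
    untouched? f = all? (λ x → f x ℤ.* y x ℤ.≟ 0ℤ) Z

    Z′ : List A
    Z′ = filter zero? Z

    U′ : Fin 3 → List (A → ℤ)
    U′ i = filter untouched? (U i)

    -- An untouched form is supported on the zero set of `y`, so it keeps its total of three on
    -- `Z′`. Discarding nonnegative forms can only lower the sums in the packing bound, which is why
    -- that bound is an inequality.
    cubic′ : Cubic U′ Z′
    cubic′ = record
      { nonneg = λ i f∈ → nonneg i (proj₁ (∈-filter⁻ untouched? f∈))
      ; total  = λ i {f} f∈ → let f∈U , untouched = ∈-filter⁻ untouched? f∈ in
                   trans (trans (∑-filter zero? Z) (∑-cong Z (vanishes {f} untouched))) (total i f∈U)
      ; packed = λ i x∈ → ℤ.≤-trans (∑-filter-≤ untouched? (U i) (λ f∈ → nonneg i f∈ _))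
                                    (packed i (filter-⊆ zero? Z x∈))
      }
      where
      vanishes : ∀ {f} → Untouched f → ∀ {x} → x ∈ₗ Z → (if does (zero? x) then f x else 0ℤ) ≡ f x
      vanishes {f} untouched {x} x∈ with zero? x
      ... | yes _    = refl
      ... | no  yx≢0 with ℤ.i*j≡0⇒i≡0∨j≡0 (f x) (All.lookup untouched x∈)
      ...   | inj₁ fx≡0 = sym fx≡0
      ...   | inj₂ yx≡0 = contradiction yx≡0 yx≢0

    rest : ∃ λ (c : A → Bool) → ∀ i {f} → f ∈ₗ U′ i → Bichromatic c f Z′
    -- `y` is nonzero on some edge, so filtering by its zero set drops at least one element.
    rest = two-colouring k Z′ (ℕ.s≤s⁻¹ (ℕ.≤-trans (filter-notAll zero? Z y≢0) ∣Z∣≤))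
             (Unique.filter⁺ zero? uniq) U′ cubic′

    c = proj₁ rest

    colour : A → Bool
    colour x = bySign (y x) (c x)

    bichromatic : ∀ i {f} → f ∈ₗ U i → Bichromatic colour f Z
    bichromatic i {f} f∈ b with untouched? f
    -- The recursion finds an edge of colour `b` on which `y` is zero, and there `colour` agrees
    -- with `c`.
    ... | yes untouched with find (proj₂ rest i (∈-filter⁺ untouched? f∈ untouched) b)
    ...   | x , x∈ , fx≢0 , cx≡b with ∈-filter⁻ zero? x∈
    ...     | x∈Z , yx≡0 = lose x∈Z (fx≢0 , trans (cong (λ a → bySign a (c x)) yx≡0) cx≡b)
    -- A touched form has a nonzero term in its zero-sum equation, so its support carries both signs
    -- of `y`.
    bichromatic i {f} f∈ true  | no touched =
      Any.map (λ {x} (fx≢0 , 0<yx) → fx≢0 , bySign-pos (c x) 0<yx)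
        (pos-in-support Z {f} {y} (nonneg i f∈) (solves i f∈) (All.¬All⇒Any¬ (λ x → f x ℤ.* y x ℤ.≟ 0ℤ) Z touched))
    bichromatic i {f} f∈ false | no touched =
      Any.map (λ {x} (fx≢0 , yx<0) → fx≢0 , bySign-neg (c x) yx<0)
        (neg-in-support Z {f} {y} (nonneg i f∈) (solves i f∈) (All.¬All⇒Any¬ (λ x → f x ℤ.* y x ℤ.≟ 0ℤ) Z touched))

-- Incidence functions of vertices.

incidence : ∀ {n} → Fin n → Subset n → ℤ
incidence v e = if does (v ∈? e) then 1ℤ else 0ℤ

incidence-nonneg : ∀ {n} (v : Fin n) e → 0ℤ ≤ incidence v e
incidence-nonneg v e with does (v ∈? e)
... | true  = +≤+ z≤n
... | false = +≤+ z≤n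

incidence≢0⇒∈ : ∀ {n} (v : Fin n) e → incidence v e ≢ 0ℤ → v ∈ e
incidence≢0⇒∈ v e ≢0 with v ∈? e
... | yes v∈e = v∈e
... | no  _   = contradiction refl ≢0

∑-incidence-edges : ∀ {n} (H : Hypergraph n) v → ∑ (edges H) (incidence v) ≡ + degree H v
∑-incidence-edges H v = begin
  ∑ (edges H) (incidence v)                       ≡⟨ ∑-filter (v ∈?_) (edges H) ⟨
  ∑ (filter (v ∈?_) (edges H)) (λ _ → 1ℤ)         ≡⟨ ∑-const 1 (filter (v ∈?_) (edges H)) ⟩
  + (degree H v ℕ.* 1)                            ≡⟨ cong +_ (ℕ.*-identityʳ (degree H v)) ⟩
  + degree H v                                    ∎
  where open ≡-Reasoning

∑-incidence-vertices : ∀ {n} (e : Subset n) → ∑ (allFin n) (λ v → incidence v e) ≡ + ∣ e ∣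
∑-incidence-vertices []                = refl
∑-incidence-vertices {suc n} (b ∷ e) = trans (cong (λ s → incidence zero (b ∷ e) ℤ.+ s) tail) (head b)
  where
  tail : ∑ (tabulate suc) (λ v → incidence v (b ∷ e)) ≡ + ∣ e ∣
  tail = begin
    ∑ (tabulate suc) (λ v → incidence v (b ∷ e))         ≡⟨ cong (λ vs → ∑ vs (λ v → incidence v (b ∷ e))) (map-tabulate {n = n} (λ v → v) suc) ⟨
    ∑ (map suc (allFin n)) (λ v → incidence v (b ∷ e))   ≡⟨ ∑-map suc (allFin n) (λ v → incidence v (b ∷ e)) ⟩
    ∑ (allFin n) (λ v → incidence v e)                   ≡⟨ ∑-incidence-vertices e ⟩
    + ∣ e ∣                                              ∎
    where open ≡-Reasoning
  head : ∀ b → incidence zero (b ∷ e) ℤ.+ + ∣ e ∣ ≡ + ∣ b ∷ e ∣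
  head true  = refl
  head false = refl

-- Restricting the vertices to a part amounts to intersecting the edge with it, which brings in the
-- size of `e ∩ p` controlled by tripartiteness.
incidence-∩ : ∀ {n} (v : Fin n) e p → (if does (v ∈? p) then incidence v e else 0ℤ) ≡ incidence v (e ∩ p)
incidence-∩ v e p with v ∈? p | v ∈? e | v ∈? (e ∩ p)
... | yes _   | yes _   | yes _    = refl
... | yes _   | no _    | no _     = refl
... | no _    | _       | no _     = refl
... | yes v∈p | yes v∈e | no v∉e∩p = contradiction (x∈p∩q⁺ (v∈e , v∈p)) v∉e∩p
... | yes _   | no v∉e  | yes v∈   = contradiction (proj₁ (x∈p∩q⁻ e p v∈)) v∉e
... | no v∉p  | _       | yes v∈   = contradiction (proj₂ (x∈p∩q⁻ e p v∈)) v∉p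

-- From colour classes to degrees.

length-filter-colour : {P : A → Set} (P? : Decidable P) (c : A → Bool) (xs : List A) →
  length (filter P? (filter (λ x → c x ≟ᵇ true) xs)) ℕ.+
  length (filter P? (filter (λ x → c x ≟ᵇ false) xs)) ≡ length (filter P? xs)
length-filter-colour P? c []       = refl
length-filter-colour P? c (x ∷ xs) with c x
... | true  with does (P? x)
...   | true  = cong suc (length-filter-colour P? c xs)
...   | false = length-filter-colour P? c xs
length-filter-colour P? c (x ∷ xs) | false with does (P? x)
...   | true  = trans (ℕ.+-suc _ _) (cong suc (length-filter-colour P? c xs))
...   | false = length-filter-colour P? c xs

1-or-2 : ∀ {a b} → 0 ℕ.< a → 0 ℕ.< b → a ℕ.+ b ≡ 3 → a ≡ 1 ⊎ a ≡ 2
1-or-2 {1} _ _ _ = inj₁ refl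
1-or-2 {2} _ _ _ = inj₂ refl
1-or-2 {suc (suc (suc a))} {suc b} _ _ eq =
  contradiction (ℕ.suc-injective (ℕ.suc-injective (ℕ.suc-injective (trans (sym (ℕ.+-suc (3 ℕ.+ a) b)) eq)))) λ ()

proposition3p1 : (n : ℕ) (H : Hypergraph n) →
    Uniform 3 H → Regular 3 H → Tripartite H →
    ∃ λ (C : Hypergraph n) →
    SpanningSubhypergraph C H ×
    ((v : Fin n) → degree C v ≡ 1 ⊎ degree C v ≡ 2)
proposition3p1 n H _ regular (P , partition , transversal) =
  C , filter-⊆ red? (edges H) , λ v →
    1-or-2 (sees v true) (sees v false) (trans (length-filter-colour (v ∈?_) c (edges H)) (regular v))
  where
  part : Fin 3 → List (Fin n)
  part i = filter (_∈? P i) (allFin n)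

  U : Fin 3 → List (Subset n → ℤ)
  U i = map incidence (part i)

  cubic : Cubic U (edges H)
  cubic = record
    { nonneg = λ i f∈ e → case-incidence i f∈ (λ f → 0ℤ ≤ f e) (λ v → incidence-nonneg v e)
    ; total  = λ i f∈ → case-incidence i f∈ (λ f → ∑ (edges H) f ≡ + 3)
                 (λ v → trans (∑-incidence-edges H v) (cong +_ (regular v)))
    -- Initially every edge meets each part exactly once.
    ; packed = λ i e∈ → ℤ.≤-reflexive (cover i e∈)
    }
    where
    case-incidence : ∀ i {f} → f ∈ₗ U i → (Q : (Subset n → ℤ) → Set) → (∀ v → Q (incidence v)) → Q f
    case-incidence i f∈ Q q with ∈-map⁻ incidence f∈
    ... | v , _ , refl = q v

    cover : ∀ i {e} → e ∈ₗ edges H → ∑ (U i) (λ f → f e) ≡ 1ℤ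
    cover i {e} e∈ = begin
      ∑ (U i) (λ f → f e)                                                      ≡⟨ ∑-map incidence (part i) (λ f → f e) ⟩
      ∑ (part i) (λ v → incidence v e)                                         ≡⟨ ∑-filter (_∈? P i) (allFin n) ⟩
      ∑ (allFin n) (λ v → if does (v ∈? P i) then incidence v e else 0ℤ)       ≡⟨ ∑-cong (allFin n) (λ {v} _ → incidence-∩ v e (P i)) ⟩
      ∑ (allFin n) (λ v → incidence v (e ∩ P i))                               ≡⟨ ∑-incidence-vertices (e ∩ P i) ⟩
      + ∣ e ∩ P i ∣                                                            ≡⟨ cong +_ (All.lookup transversal e∈ i) ⟩
      1ℤ                                                                       ∎
      where open ≡-Reasoning

  colouring : ∃ λ (c : Subset n → Bool) → ∀ i {f} → f ∈ₗ U i → Bichromatic c f (edges H)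
  colouring = Colouring.two-colouring (Vec.≡-dec _≟ᵇ_) (length (edges H)) (edges H) ℕ.≤-refl (unique H) U cubic

  c : Subset n → Bool
  c = proj₁ colouring

  red? : Decidable (λ e → c e ≡ true)
  red? e = c e ≟ᵇ true

  C : Hypergraph n
  C = record { edges = filter red? (edges H) ; unique = Unique.filter⁺ red? (unique H) }

  -- The part containing `v` supplies the form `incidence v`, whose support has an edge of colour
  -- `b`. Colour `true` makes the degree in `C` positive, and colour `false` keeps it below three.
  sees : ∀ v b → 0 ℕ.< length (filter (v ∈?_) (filter (λ e → c e ≟ᵇ b) (edges H)))
  sees v b with partition v
  ... | i , v∈Pi , _ with find (proj₂ colouring i (∈-map⁺ incidence (∈-filter⁺ (_∈? P i) (∈-allFin v) v∈Pi)) b)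
  ...   | e , e∈ , ≢0 , ce≡b =
    filter-some (v ∈?_) (lose (∈-filter⁺ (λ e → c e ≟ᵇ b) e∈ ce≡b) (incidence≢0⇒∈ v e ≢0))
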